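{- Let ${\cal U} = (U, I)$ be any model of the first-order theory with identity $\mathrm{ZF}$. Then ${\cal U}$ (with the translation of membership given by $I$) is a transitive model of the first-order theory without identity $Z\Phi$.
   Context: **Interpretations and models.** An interpretation for a language $\mathcal L$ is an ordered pair ${\cal U}=(U,I)$, where $U$ is the universe of ${\cal U}$ and $I$ is the interpretation function, mapping the symbols of $\mathcal L$ to appropriate relations, functions and constants in $U$. If all translated axioms of a first-order theory hold in ${\cal U}$, then ${\cal U}$ is a model of that theory. In models of $\mathrm{ZF}$ the predicate $=$ is translated as identity. The translation of $\in$ is written $\in_U$. **Transitivity.** An interpretation ${\cal U}=(U,I)$ of the language of set theory is transitive iff, for any $x$ and any $y$, "$x$ belonging to $U$ and $y$ belonging to $x$" entail "$y$ belonging to $U$", where "belonging" is the translation of $\in$ by means of $I$. **$\mathrm{ZF}$.** First-order theory with identity $=$ and one binary predicate letter $\in$; proper axioms: - ZF1 (Extensionality): $\forall x\forall y(\forall z(z\in x\Leftrightarrow z\in y)\Rightarrow x=y)$. - ZF2 (Empty Set): $\exists x\forall y(y\notin x)$. - ZF3 (Pair): $\forall x\forall y\exists z\forall t(t\in z\Leftrightarrow(t=x\vee t=y))$. - ZF4 (Power): $\forall x\exists y\forall t(t\in y\Leftrightarrow t\subseteq x)$, where $t\subseteq x$ abbreviates $\forall r(r\in t\Rightarrow r\in x)$. - ZF5 (Union): $\forall x\exists y\forall z(z\in y\Leftrightarrow\exists w(z\in w\wedge w\in x))$. - ZF6 (Separation scheme): $\forall z\exists x\forall y(y\in x\Leftrightarrow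 y\in z\wedge\mathcal F(y))$, for each formula $\mathcal F(y)$ with no free occurrences of $x$. - ZF7 (Infinity): $\exists x(\varnothing\in x\wedge\forall y(y\in x\Rightarrow S(y)\in x))$, where $\varnothing$ is the empty set and $S(y)=y\cup\{y\}$. - ZF8 (Replacement scheme): $\forall x\exists!y\,\mathcal F(x,y)\Rightarrow\forall z\exists w\forall t(t\in w\Leftrightarrow\exists s(s\in z\wedge\mathcal F(s,t)))$, for each formula $\mathcal F(x,y)$ in which all occurrences of $x$ and $y$ are free, where $\exists!y\,\mathcal F(x,y)$ means $\exists y(\mathcal F(x,y)\wedge\forall z(\mathcal F(x,z)\Rightarrow y=z))$. - ZF9 (Regularity): $\forall x(x\neq\varnothing\Rightarrow\exists y(y\in x\wedge x\cap y=\varnothing))$. **$Z\Phi$.** First-order theory without identity, with the single primitive binary predicate letter $\in$. Its proper axioms are ZF2–ZF9 (not ZF1), with every occurrence of a formula $x=y$ replaced by $\forall t(t\in x\Leftrightarrow t\in y)$ and every occurrence of $x\neq y$ replaced by $\exists t((t\in x\wedge t\notin y)\vee(t\in y\wedge t\notin x))$. Formulas $\mathcal F$ in the schemes are formulas of the language with $\in$ only. The defined terms $\varnothing$, $S(y)$, $\cap$ are unfolded in terms of $\in$: "$\varnothing\in x$" means that some $e\in x$ has no elements, and "$S(y)\in x$" means that there is $s\in x$ with $\forall t(t\in s\Leftrightarrow(t\in y\vee\forall r(r\in t\Leftrightarrow r\in y)))$. -}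

module Defs where

open import Data.Fin using (Fin; zero; suc; #_; _↑ʳ_)
open import Data.Nat using (ℕ; _+_)
open import Data.Product using (_×_; ∃-syntax)
open import Data.Sum using (_⊎_)
open import Data.Vec.Functional using (Vector; []; _∷_)
open import Level using (Level; 0ℓ) renaming (suc to lsuc)
open import Relation.Binary.Core using (Rel)
open import Relation.Binary.PropositionalEquality using (_≡_)
open import Relation.Nullary using (¬_)
open import Relation.Unary using (Pred; _∈_)

-- Identity is treated as a logical symbol, which a language has or lacks;
-- membership is the only other predicate letter.
data Language : Set where
  with-identity without-identity : Language

infix  8 _∈'_ _≐_
infixr 7 ¬'_ ∀'_ ∃'_
infixr 6 _∧'_
infixr 5 _∨'_
infixr 4 _⇒'_
infix  3 _⇔'_

-- Formula L n has its free variables in Fin n, as de Bruijn indices: zero is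
-- bound by the innermost quantifier.
data Formula : Language → ℕ → Set where
  _∈'_  : ∀ {L n} → Fin n → Fin n → Formula L n
  _≐_   : ∀ {n} → Fin n → Fin n → Formula with-identity n
  ¬'_   : ∀ {L n} → Formula L n → Formula L n
  _∧'_  : ∀ {L n} → Formula L n → Formula L n → Formula L n
  _∨'_  : ∀ {L n} → Formula L n → Formula L n → Formula L n
  _⇒'_  : ∀ {L n} → Formula L n → Formula L n → Formula L n
  ∀'_   : ∀ {L n} → Formula L (1 + n) → Formula L n
  ∃'_   : ∀ {L n} → Formula L (1 + n) → Formula L n

_⇔'_ : ∀ {L n} → Formula L n → Formula L n → Formula L n
φ ⇔' ψ = (φ ⇒' ψ) ∧' (ψ ⇒' φ)

lift : ∀ {m n} → (Fin m → Fin n) → Fin (1 + m) → Fin (1 + n)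
lift f zero    = zero
lift f (suc i) = suc (f i)

rename : ∀ {L m n} → (Fin m → Fin n) → Formula L m → Formula L n
rename f (i ∈' j) = f i ∈' f j
rename f (i ≐ j)  = f i ≐ f j
rename f (¬' φ)   = ¬' rename f φ
rename f (φ ∧' ψ) = rename f φ ∧' rename f ψ
rename f (φ ∨' ψ) = rename f φ ∨' rename f ψ
rename f (φ ⇒' ψ) = rename f φ ⇒' rename f ψ
rename f (∀' φ)   = ∀' rename (lift f) φ
rename f (∃' φ)   = ∃' rename (lift f) φ

-- For F(v₀, v₁, p⃗) and a context of k bound variables in front of the
-- parameters p⃗, F [ k ∣ i , j ] is F(i, j, p⃗).  The parameters are kept clear
-- of the k bound variables, so none of them is captured.
_[_∣_,_] : ∀ {L n} → Formula L (2 + n) →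
           (k : ℕ) → Fin (k + n) → Fin (k + n) → Formula L (k + n)
F [ k ∣ i , j ] = rename (i ∷ j ∷ (k ↑ʳ_)) F

-- The universe is a subset U of an ambient domain and ∈ᵤ is a relation in U.
-- The ambient domain gives "y belongs to U" a meaning for a y not already known
-- to be in U, as transitivity requires.
record Interpretation (ℓ : Level) : Set (lsuc ℓ) where
  infix 4 _∈ᵤ_
  field
    Domain : Set ℓ
    U      : Pred Domain ℓ
    _∈ᵤ_   : Rel Domain ℓ
    ∈ᵤ⊆U×U : ∀ {x y} → x ∈ᵤ y → x ∈ U × y ∈ U

Transitive : ∀ {ℓ} → Interpretation ℓ → Set ℓ
Transitive 𝒰 = ∀ x y → x ∈ U → y ∈ᵤ x → y ∈ U
  where open Interpretation 𝒰

module _ {ℓ} (𝒰 : Interpretation ℓ) where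
  open Interpretation 𝒰

  Satisfies : ∀ {L n} → Vector Domain n → Formula L n → Set ℓ
  Satisfies ρ (i ∈' j) = ρ i ∈ᵤ ρ j
  Satisfies ρ (i ≐ j)  = ρ i ≡ ρ j
  Satisfies ρ (¬' φ)   = ¬ Satisfies ρ φ
  Satisfies ρ (φ ∧' ψ) = Satisfies ρ φ × Satisfies ρ ψ
  Satisfies ρ (φ ∨' ψ) = Satisfies ρ φ ⊎ Satisfies ρ ψ
  Satisfies ρ (φ ⇒' ψ) = Satisfies ρ φ → Satisfies ρ ψ
  Satisfies ρ (∀' φ)   = ∀ x → x ∈ U → Satisfies (x ∷ ρ) φ
  Satisfies ρ (∃' φ)   = ∃[ x ] x ∈ U × Satisfies (x ∷ ρ) φ

infix 4 _⊨_ _IsModelOf_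

-- A formula with free variables holds when its universal closure does.
_⊨_ : ∀ {ℓ L n} → Interpretation ℓ → Formula L n → Set ℓ
𝒰 ⊨ φ = ∀ ρ → (∀ i → ρ i ∈ U) → Satisfies 𝒰 ρ φ
  where open Interpretation 𝒰

-- A theory is given by its proper axioms.
Theory : Language → Set₁
Theory L = ∀ {n} → Pred (Formula L n) 0ℓ

_IsModelOf_ : ∀ {ℓ L} → Interpretation ℓ → Theory L → Set ℓ
𝒰 IsModelOf T = ∀ {n} {φ : Formula _ n} → φ ∈ T → 𝒰 ⊨ φ

-- ZF without extensionality, with eq x y and neq x y standing for equality and
-- inequality.  A defined term is eliminated at the atomic formula containing
-- it: for instance, φ(∅) becomes ∃e (e is empty ∧ φ(e)).
module Axioms {L : Language}
  (eq neq : ∀ {n} → Fin n → Fin n → Formula L n) where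

  private
    variable
      n : ℕ

  infix 8 _≈_ _≉_ _⊆'_

  _≈_ : Fin n → Fin n → Formula L n
  _≈_ = eq

  _≉_ : Fin n → Fin n → Formula L n
  _≉_ = neq

  IsEmpty : Fin n → Formula L n
  IsEmpty x = ∀' ¬' (zero ∈' suc x)

  _⊆'_ : Fin n → Fin n → Formula L n
  x ⊆' y = ∀' (zero ∈' suc x ⇒' zero ∈' suc y)

  -- s = y ∪ {y}
  IsSuccessor : Fin n → Fin n → Formula L n
  IsSuccessor s y = ∀' (zero ∈' suc s ⇔' zero ∈' suc y ∨' zero ≈ suc y)

  -- i = x ∩ y
  IsIntersection : Fin n → Fin n → Fin n → Formula L n
  IsIntersection i x y =
    ∀' (zero ∈' suc i ⇔' zero ∈' suc x ∧' zero ∈' suc y)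

  empty-set : Formula L 0
  empty-set = ∃' ∀' ¬' (# 0 ∈' # 1)

  pair : Formula L 0
  pair = ∀' ∀' ∃' ∀' (# 0 ∈' # 1 ⇔' # 0 ≈ # 3 ∨' # 0 ≈ # 2)

  power : Formula L 0
  power = ∀' ∃' ∀' (# 0 ∈' # 1 ⇔' # 0 ⊆' # 2)

  union : Formula L 0
  union = ∀' ∃' ∀' (# 0 ∈' # 1 ⇔' ∃' (# 1 ∈' # 0 ∧' # 0 ∈' # 3))

  -- F(y, z, p⃗): the scheme forbids only x, so z may occur in F.
  separation : Formula L (2 + n) → Formula L n
  separation F = ∀' ∃' ∀' (# 0 ∈' # 1 ⇔' # 0 ∈' # 2 ∧' F [ 3 ∣ # 0 , # 2 ])

  infinity : Formula L 0
  infinity =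
    ∃' (∃' (# 0 ∈' # 1 ∧' IsEmpty (# 0)) ∧'
        ∀' (# 0 ∈' # 1 ⇒' ∃' (# 0 ∈' # 2 ∧' IsSuccessor (# 0) (# 1))))

  -- F(x, y, p⃗): no variable bound by the scheme other than x and y occurs in F.
  replacement : Formula L (2 + n) → Formula L n
  replacement F =
    ∀' ∃' (F [ 2 ∣ # 1 , # 0 ] ∧' ∀' (F [ 3 ∣ # 2 , # 0 ] ⇒' # 1 ≈ # 0))
    ⇒'
    ∀' ∃' ∀' (# 0 ∈' # 1 ⇔' ∃' (# 0 ∈' # 3 ∧' F [ 4 ∣ # 0 , # 1 ]))

  regularity : Formula L 0
  regularity =
    ∀' (∃' (IsEmpty (# 0) ∧' # 1 ≉ # 0) ⇒'
        ∃' (# 0 ∈' # 1 ∧'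
            ∃' (IsIntersection (# 0) (# 2) (# 1) ∧'
                ∃' (IsEmpty (# 0) ∧' # 1 ≈ # 0))))

  data Axiom : Theory L where
    ZF2 : Axiom empty-set
    ZF3 : Axiom pair
    ZF4 : Axiom power
    ZF5 : Axiom union
    ZF6 : (F : Formula L (2 + n)) → Axiom (separation F)
    ZF7 : Axiom infinity
    ZF8 : (F : Formula L (2 + n)) → Axiom (replacement F)
    ZF9 : Axiom regularity

infix 8 _≠'_ _coext_ _¬coext_

_≠'_ : ∀ {n} → Fin n → Fin n → Formula with-identity n
x ≠' y = ¬' (x ≐ y)

_coext_ : ∀ {L n} → Fin n → Fin n → Formula L n
x coext y = ∀' (zero ∈' suc x ⇔' zero ∈' suc y)

_¬coext_ : ∀ {L n} → Fin n → Fin n → Formula L n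
x ¬coext y = ∃' ((zero ∈' suc x ∧' ¬' (zero ∈' suc y)) ∨'
                 (zero ∈' suc y ∧' ¬' (zero ∈' suc x)))

extensionality : Formula with-identity 0
extensionality = ∀' ∀' (# 1 coext # 0 ⇒' # 1 ≐ # 0)

data ZF : Theory with-identity where
  ZF1   : ZF extensionality
  ZF2-9 : ∀ {n} {φ : Formula with-identity n} →
          Axioms.Axiom _≐_ _≠'_ φ → ZF φ

ZΦ : Theory without-identity
ZΦ = Axioms.Axiom _coext_ _¬coext_

{-# OPTIONS --safe #-}
-- Replacing x = y by coextensionality turns every axiom of ZF2–ZF9 into the
-- corresponding axiom of ZΦ, except that ZF9 of ZΦ has a constructively stronger
-- hypothesis.  By extensionality the replacement does not affect truth in a
-- model of ZF.  A scheme of ZΦ at F is the image of the scheme of ZF at F, read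
-- as a formula of the larger language.
module Submission where

open import Defs
open import Data.Fin using (Fin; zero; suc; #_; _↑ʳ_)
open import Data.Nat using (ℕ; _+_)
open import Data.Product using (_×_; _,_; proj₁; proj₂)
open import Data.Product.Function.NonDependent.Propositional using (_×-⇔_)
open import Data.Sum using (inj₁; inj₂)
open import Data.Sum.Function.Propositional using (_⊎-⇔_)
open import Data.Vec.Functional using (Vector; []; _∷_)
open import Function.Bundles using (_⇔_; mk⇔; module Equivalence)
open import Function.Construct.Identity using (⇔-id)
open import Function.Related.TypeIsomorphisms using (→-cong-⇔; ¬-cong-⇔)
open import Relation.Binary.PropositionalEquality
  using (_≡_; refl; cong; cong₂; subst; sym)
open import Relation.Unary using (_∈_)

open Equivalence using (to; from)

private
  variable
    m n : ℕ

-- The image of `x ≠' y` is `¬' (x coext y)` rather than `x ¬coext y`, which is why regularity gets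
-- a lemma of its own.
≐⇒coext : Formula with-identity n → Formula without-identity n
≐⇒coext (i ∈' j) = i ∈' j
≐⇒coext (i ≐ j)  = i coext j
≐⇒coext (¬' φ)   = ¬' ≐⇒coext φ
≐⇒coext (φ ∧' ψ) = ≐⇒coext φ ∧' ≐⇒coext ψ
≐⇒coext (φ ∨' ψ) = ≐⇒coext φ ∨' ≐⇒coext ψ
≐⇒coext (φ ⇒' ψ) = ≐⇒coext φ ⇒' ≐⇒coext ψ
≐⇒coext (∀' φ)   = ∀' ≐⇒coext φ
≐⇒coext (∃' φ)   = ∃' ≐⇒coext φ

embed : Formula without-identity n → Formula with-identity n
embed (i ∈' j) = i ∈' j
embed (¬' φ)   = ¬' embed φ
embed (φ ∧' ψ) = embed φ ∧' embed ψ
embed (φ ∨' ψ) = embed φ ∨' embed ψ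
embed (φ ⇒' ψ) = embed φ ⇒' embed ψ
embed (∀' φ)   = ∀' embed φ
embed (∃' φ)   = ∃' embed φ

-- `embed` produces no `≐`, so `≐⇒coext` merely undoes it. The renaming sits in between because an
-- instance of a scheme contains `F` only through substitutions `F [ k ∣ i , j ]`.
≐⇒coext-rename-embed : (f : Fin m → Fin n) (φ : Formula without-identity m) →
                       ≐⇒coext (rename f (embed φ)) ≡ rename f φ
≐⇒coext-rename-embed f (i ∈' j) = refl
≐⇒coext-rename-embed f (¬' φ)   = cong ¬'_ (≐⇒coext-rename-embed f φ)
≐⇒coext-rename-embed f (φ ∧' ψ) =
  cong₂ _∧'_ (≐⇒coext-rename-embed f φ) (≐⇒coext-rename-embed f ψ)
≐⇒coext-rename-embed f (φ ∨' ψ) =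
  cong₂ _∨'_ (≐⇒coext-rename-embed f φ) (≐⇒coext-rename-embed f ψ)
≐⇒coext-rename-embed f (φ ⇒' ψ) =
  cong₂ _⇒'_ (≐⇒coext-rename-embed f φ) (≐⇒coext-rename-embed f ψ)
≐⇒coext-rename-embed f (∀' φ)   = cong ∀'_ (≐⇒coext-rename-embed (lift f) φ)
≐⇒coext-rename-embed f (∃' φ)   = cong ∃'_ (≐⇒coext-rename-embed (lift f) φ)

module With    = Axioms _≐_ _≠'_
module Without = Axioms {without-identity} _coext_ _¬coext_

≐⇒coext-separation : (F : Formula without-identity (2 + n)) →
  ≐⇒coext (With.separation (embed F)) ≡ Without.separation F
≐⇒coext-separation F
  rewrite ≐⇒coext-rename-embed (# 0 ∷ # 2 ∷ (3 ↑ʳ_)) F = refl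

≐⇒coext-replacement : (F : Formula without-identity (2 + n)) →
  ≐⇒coext (With.replacement (embed F)) ≡ Without.replacement F
≐⇒coext-replacement F
  -- One equation for each of the three substitution instances of `F`; everything around them
  -- computes.
  rewrite ≐⇒coext-rename-embed (# 1 ∷ # 0 ∷ (2 ↑ʳ_)) F
        | ≐⇒coext-rename-embed (# 2 ∷ # 0 ∷ (3 ↑ʳ_)) F
        | ≐⇒coext-rename-embed (# 0 ∷ # 1 ∷ (4 ↑ʳ_)) F = refl

module _ {ℓ} (𝒰 : Interpretation ℓ) where
  open Interpretation 𝒰

  transitive : Transitive 𝒰
  transitive _ _ _ y∈x = proj₁ (∈ᵤ⊆U×U y∈x)

  ∷-in-U : ∀ {x} {ρ : Vector Domain n} → x ∈ U → (∀ i → ρ i ∈ U) →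
           ∀ i → (x ∷ ρ) i ∈ U
  ∷-in-U x∈U ρ∈U zero    = x∈U
  ∷-in-U x∈U ρ∈U (suc i) = ρ∈U i

  -- An element of exactly one of the two sets refutes coextensionality. The converse would call for
  -- classical reasoning.
  ¬coext⇒¬'coext : (ρ : Vector Domain n) (i j : Fin n) →
    Satisfies 𝒰 {without-identity} ρ (i ¬coext j) →
    Satisfies 𝒰 {without-identity} ρ (¬' (i coext j))
  ¬coext⇒¬'coext ρ i j (z , z∈U , inj₁ (z∈i , z∉j)) i≈j =
    z∉j (proj₁ (i≈j z z∈U) z∈i)
  ¬coext⇒¬'coext ρ i j (z , z∈U , inj₂ (z∈j , z∉i)) i≈j =
    z∉i (proj₂ (i≈j z z∈U) z∈j)

  -- Inequality occurs only in the antecedent of ZF9, so the implication from `¬coext` to negated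
  -- `coext` is the direction required.
  regularity-from-≐ : 𝒰 ⊨ ≐⇒coext With.regularity → 𝒰 ⊨ Without.regularity
  regularity-from-≐ reg ρ ρ∈U x x∈U (e , e∈U , e-empty , x≉e) =
    reg ρ ρ∈U x x∈U
      (e , e∈U , e-empty , ¬coext⇒¬'coext (e ∷ x ∷ ρ) (# 1) (# 0) x≉e)

  module _ (ext : 𝒰 ⊨ extensionality) where

    ≐⇔coext : (ρ : Vector Domain n) → (∀ i → ρ i ∈ U) → (i j : Fin n) →
      ρ i ≡ ρ j ⇔ Satisfies 𝒰 {without-identity} ρ (i coext j)
    ≐⇔coext ρ ρ∈U i j = mk⇔
      (λ eq z _ → subst (z ∈ᵤ_) eq , subst (z ∈ᵤ_) (sym eq))
      -- Extensionality is closed, hence the empty valuation. Its antecedent at `ρ i` and `ρ j`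
      -- unfolds to the same type as `i coext j` under `ρ`.
      (ext [] (λ ()) (ρ i) (ρ∈U i) (ρ j) (ρ∈U j))

    -- Induction on `φ`. An equivalence is carried, not one implication, since `¬'` and `⇒'` reverse
    -- direction. Valuations stay in `U` under the quantifiers, as extensionality speaks only of
    -- elements of `U`.
    Satisfies-≐⇒coext : (φ : Formula with-identity n) (ρ : Vector Domain n) →
      (∀ i → ρ i ∈ U) → Satisfies 𝒰 ρ φ ⇔ Satisfies 𝒰 ρ (≐⇒coext φ)
    Satisfies-≐⇒coext (i ∈' j) ρ ρ∈U = ⇔-id _
    Satisfies-≐⇒coext (i ≐ j)  ρ ρ∈U = ≐⇔coext ρ ρ∈U i j
    Satisfies-≐⇒coext (¬' φ)   ρ ρ∈U = ¬-cong-⇔ (Satisfies-≐⇒coext φ ρ ρ∈U)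
    Satisfies-≐⇒coext (φ ∧' ψ) ρ ρ∈U =
      Satisfies-≐⇒coext φ ρ ρ∈U ×-⇔ Satisfies-≐⇒coext ψ ρ ρ∈U
    Satisfies-≐⇒coext (φ ∨' ψ) ρ ρ∈U =
      Satisfies-≐⇒coext φ ρ ρ∈U ⊎-⇔ Satisfies-≐⇒coext ψ ρ ρ∈U
    Satisfies-≐⇒coext (φ ⇒' ψ) ρ ρ∈U =
      →-cong-⇔ (Satisfies-≐⇒coext φ ρ ρ∈U) (Satisfies-≐⇒coext ψ ρ ρ∈U)
    Satisfies-≐⇒coext (∀' φ)   ρ ρ∈U = mk⇔
      (λ s x x∈U → to   (Satisfies-≐⇒coext φ _ (∷-in-U x∈U ρ∈U)) (s x x∈U))
      (λ s x x∈U → from (Satisfies-≐⇒coext φ _ (∷-in-U x∈U ρ∈U)) (s x x∈U))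
    Satisfies-≐⇒coext (∃' φ)   ρ ρ∈U = mk⇔
      (λ (x , x∈U , s) →
        x , x∈U , to   (Satisfies-≐⇒coext φ _ (∷-in-U x∈U ρ∈U)) s)
      (λ (x , x∈U , s) →
        x , x∈U , from (Satisfies-≐⇒coext φ _ (∷-in-U x∈U ρ∈U)) s)

    ⊨-≐⇒coext : (φ : Formula with-identity n) → 𝒰 ⊨ φ → 𝒰 ⊨ ≐⇒coext φ
    ⊨-≐⇒coext φ ⊨φ ρ ρ∈U = to (Satisfies-≐⇒coext φ ρ ρ∈U) (⊨φ ρ ρ∈U)

  ZF⇒ZΦ : 𝒰 IsModelOf ZF → 𝒰 IsModelOf ZΦ
  ZF⇒ZΦ zf = go
    where
    image : {φ : Formula with-identity n} → With.Axiom φ → 𝒰 ⊨ ≐⇒coext φ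
    image {φ = φ} ax = ⊨-≐⇒coext (zf ZF1) φ (zf (ZF2-9 ax))

    go : 𝒰 IsModelOf ZΦ
    -- For the single axioms the image under `≐⇒coext` is the axiom of `ZΦ` by computation; the
    -- schemes need a transport because `F` is arbitrary.
    go Without.ZF2     = image With.ZF2
    go Without.ZF3     = image With.ZF3
    go Without.ZF4     = image With.ZF4
    go Without.ZF5     = image With.ZF5
    go (Without.ZF6 F) =
      subst (𝒰 ⊨_) (≐⇒coext-separation F) (image (With.ZF6 (embed F)))
    go Without.ZF7     = image With.ZF7
    go (Without.ZF8 F) =
      subst (𝒰 ⊨_) (≐⇒coext-replacement F) (image (With.ZF8 (embed F)))
    go Without.ZF9     = regularity-from-≐ (image With.ZF9)

proposition1 : ∀ {ℓ} (𝒰 : Interpretation ℓ) →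
    𝒰 IsModelOf ZF → Transitive 𝒰 × 𝒰 IsModelOf ZΦ
proposition1 𝒰 zf = transitive 𝒰 , ZF⇒ZΦ 𝒰 zf
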